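{- Every quasiorder on a set $A$ is the intersection of a family of half-space quasiorders on $A$.
   Context: A quasiorder on $A$ is a reflexive and transitive relation; $\Delta_A=\{(a,a)\mid a\in A\}$. A quasiorder $\alpha$ on $A$ is a half-space if there is a quasiorder $\beta$ on $A$ with $\alpha\cup\beta=A\times A$ and $\alpha\cap\beta=\Delta_A$. -}

module Defs where

open import Level using (Level; _⊔_; suc)
open import Data.Product.Base using (_×_; Σ-syntax)
open import Relation.Binary.Core using (Rel; _⇔_)
open import Relation.Binary.Structures using (IsPreorder)
open import Relation.Binary.PropositionalEquality.Core using (_≡_)
open import Relation.Binary.Construct.Always using (Always)
open import Relation.Binary.Construct.Union using (_∪_)
open import Relation.Binary.Construct.Intersection using (_∩_)

private
  variable
    a i ℓ : Level

-- Relations are compared as sets of pairs, i.e. by mutual inclusion _⇔_.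

IsQuasiorder : {A : Set a} → Rel A ℓ → Set (a ⊔ ℓ)
IsQuasiorder α = IsPreorder _≡_ α

IsHalfSpace : {A : Set a} → Rel A ℓ → Set (a ⊔ suc ℓ)
IsHalfSpace {ℓ = ℓ} {A = A} α =
  IsQuasiorder α ×
  (Σ[ β ∈ Rel A ℓ ]
     IsQuasiorder β ×
     ((α ∪ β) ⇔ Always {ℓ = ℓ}) ×
     ((α ∩ β) ⇔ _≡_))

-- For an empty index type this is the full relation A × A.
⋂ : {A : Set a} {I : Set i} → (I → Rel A ℓ) → Rel A (i ⊔ ℓ)
⋂ {I = I} H x y = (k : I) → H k x y

IsIntersectionOfHalfSpaces : {A : Set a} → Rel A ℓ → Set (suc (a ⊔ ℓ))
IsIntersectionOfHalfSpaces {a = a} {ℓ = ℓ} {A = A} α =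
  Σ[ I ∈ Set (a ⊔ ℓ) ]
  Σ[ H ∈ (I → Rel A ℓ) ]
    ((k : I) → IsHalfSpace (H k)) × (α ⇔ ⋂ H)

{-# OPTIONS --safe #-}

-- For x ∈ A let Hₓ be the quasiorder { (u , v) ∣ x α u implies x α v }.  A pair
-- lies outside Hₓ iff it leads from the up-set of x to the complement of that
-- up-set, so two such pairs never compose and the complement of Hₓ together
-- with the diagonal is transitive: Hₓ is a half-space.  By transitivity α is
-- contained in every Hₓ, and if (x , v) ∈ Hₓ then x α v, since x α x.
module Submission where

open import Defs
open import Level using (Level; _⊔_; Lift; lift; lower)
open import Data.Empty using (⊥-elim)
open import Data.Product.Base using (_,_)
open import Data.Sum.Base using (_⊎_; inj₁; inj₂)
open import Function.Base using (id; _∘_; const)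
open import Relation.Binary.Core using (Rel)
open import Relation.Binary.Definitions using (DecidableEquality; Transitive)
open import Relation.Binary.PropositionalEquality.Core using (refl)
open import Relation.Binary.PropositionalEquality.Properties using (isEquivalence)
open import Relation.Binary.Structures using (module IsPreorder)
open import Relation.Nullary.Decidable.Core using (yes; no; True; toWitness; fromWitness; map′)
open import Relation.Nullary.Negation.Core using (¬_)
open import Relation.Unary using (Pred; Decidable)
open import Axiom.ExcludedMiddle using (ExcludedMiddle)
open import Axiom.Extensionality.Propositional using (Extensionality)

private
  variable
    a p : Level
    A : Set a

-- A single instance at level `a ⊔ ℓ` thus decides both equality on `A`, at level `a`, and
-- membership in `α x`, at level `ℓ`.
excludedMiddle-lower : ∀ p q → ExcludedMiddle (p ⊔ q) → ExcludedMiddle p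
excludedMiddle-lower p q em = map′ lower lift (em {Lift q _})

Preserves : Pred A p → Rel A p
Preserves P u v = P u → P v

preserves-isQuasiorder : (P : Pred A p) → IsQuasiorder (Preserves P)
preserves-isQuasiorder P = record
  { isEquivalence = isEquivalence
  ; reflexive     = λ { refl → id }
  ; trans         = λ f g → g ∘ f
  }

module _ (_≟_ : DecidableEquality A) (P : Pred A p) where

  -- The diagonal is included as True (u ≟ v) because u ≡ v itself lives in
  -- the universe of A, whereas both quasiorders of a half-space must live in
  -- the universe of P.
  NotPreservesOrEqual : Rel A p
  NotPreservesOrEqual u v = ¬ Preserves P u v ⊎ True (u ≟ v)

  notPreservesOrEqual-trans : Transitive NotPreservesOrEqual
  notPreservesOrEqual-trans (inj₁ ¬uv) (inj₁ ¬vw) =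
    -- A proof of `P v` would make `P u → P v` constant, against `¬uv`; so `P v` fails and
    -- `P v → P w` holds vacuously, against `¬vw`.
    ⊥-elim (¬vw λ Pv → ⊥-elim (¬uv (const Pv)))
  notPreservesOrEqual-trans {i} {j} (inj₂ i≡j) q with refl ← toWitness {a? = i ≟ j} i≡j = q
  notPreservesOrEqual-trans {_} {j} {k} p@(inj₁ _) (inj₂ j≡k) with refl ← toWitness {a? = j ≟ k} j≡k = p

  notPreservesOrEqual-isQuasiorder : IsQuasiorder NotPreservesOrEqual
  notPreservesOrEqual-isQuasiorder = record
    { isEquivalence = isEquivalence
    ; reflexive     = inj₂ ∘ fromWitness
    ; trans         = notPreservesOrEqual-trans
    }

  preserves-isHalfSpace : Decidable P → IsHalfSpace (Preserves P)
  preserves-isHalfSpace P? =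
      preserves-isQuasiorder P
    , NotPreservesOrEqual
    , notPreservesOrEqual-isQuasiorder
    , (_ , λ {u} {v} _ → total u v)
    , ( (λ { (r , inj₁ ¬r) → ⊥-elim (¬r r) ; (_ , inj₂ u≡v) → toWitness u≡v })
      , λ { refl → id , inj₂ (fromWitness refl) })
    where
    -- Here `P?` enters: the implication can fail only when `P u` holds and `P v` does not.
    total : ∀ u v → Preserves P u v ⊎ NotPreservesOrEqual u v
    total u v with P? u | P? v
    ... | _      | yes Pv = inj₁ (const Pv)
    ... | no ¬Pu | no _   = inj₁ (⊥-elim ∘ ¬Pu)
    ... | yes Pu | no ¬Pv = inj₂ (inj₁ λ r → ¬Pv (r Pu))

theorem2p9 : ∀ {a ℓ : Level} →
    ExcludedMiddle (a ⊔ ℓ) → Extensionality a a →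
    (A : Set a) (α : Rel A ℓ) →
    IsQuasiorder α → IsIntersectionOfHalfSpaces α
theorem2p9 {a} {ℓ} em _ A α isQuasiorder =
    -- One half-space per point of `A`; lifting puts the index set at the required level `a ⊔ ℓ`.
    Lift ℓ A
  , (λ (lift x) → Preserves (α x))
  , (λ (lift x) → preserves-isHalfSpace (λ _ _ → excludedMiddle-lower a ℓ em) (α x)
                                        (λ _ → excludedMiddle-lower ℓ a em))
  , ( (λ uv (lift x) xu → α.trans xu uv)
    , λ {u} h → h (lift u) α.refl)
  where module α = IsPreorder isQuasiorder
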